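{- Let $n \geq 2$ and $k \geq 3$ be integers and let $m \geq k\,\alpha_k(B_n)$ be an integer. Let $w$ and $w'$ be $m$-weightings of $B_n$ such that $w$ is uniform-$\alpha$ and $w'$ is uniform on a largest $k$-clique independent set of $B_n$. Then $\pi_k(B_n(w)) < \pi_k(B_n(w'))$.
   Context: All graphs are simple. $\mathbb{N}_0 = \{0,1,2,\dots\}$, $[n]=\{1,\dots,n\}$. For a graph $G$, a function $w: V(G) \to \mathbb{N}_0$ with $\sum_{v \in V(G)} w(v) = m$ is an $m$-weighting of $G$. $G(w)$ is the graph obtained from $G$ by replacing each vertex $v$ by a clique $K^v$ on $w(v)$ vertices and joining every vertex of $K^u$ to every vertex of $K^v$ whenever $uv \in E(G)$. $\pi_k(H)$ denotes the number of $k$-cliques of a graph $H$. A subset $I \subseteq V(G)$ is a $k$-clique independent set if no $k$ vertices of $I$ induce a $k$-clique of $G$; $\alpha_k(G)$ is the maximum size of a $k$-clique independent set. An $m$-weighting $w$ is uniform on $U \subseteq V(G)$ if $w(v)=0$ for all $v \notin U$ and $w(u) \in \{\lfloor m/|U|\rfloor, \lceil m/|U| \rceil\}$ for all $u \in U$; $w$ is uniform-$\alpha$ if it is uniform on some independent set of $G$ of maximum size. The Sperner graph $B_n$ has vertex set $2^{[n]}$ and edges $XY$ for all $X \subsetneq Y \subseteq [n]$. -}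

module Defs where

open import Data.Nat using (ℕ; zero; suc; _+_; _*_; _≤_; _<_; _/_)
open import Data.Nat.Properties using () renaming (_≟_ to _≟ℕ_)
open import Data.Bool using (Bool; true; false)
open import Data.Bool.Properties using () renaming (_≟_ to _≟B_)
open import Data.List using (List; []; _∷_; [_]; _++_; map; concatMap; length; filter; upTo)
open import Data.Nat.ListAction using (sum)
open import Data.List.Relation.Unary.AllPairs using (AllPairs; allPairs?)
open import Data.List.Relation.Unary.All using (All)
open import Data.List.Relation.Unary.Unique.Propositional using (Unique)
open import Data.List.Relation.Binary.Sublist.Propositional using (_⊆_)
open import Data.List.Membership.Propositional using (_∈_; _∉_)
open import Data.Vec using (Vec; []; _∷_)
open import Data.Vec.Properties using (≡-dec)
open import Data.Fin.Subset using (Subset; _⊂_)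
open import Data.Fin.Subset.Properties using (_⊂?_)
open import Data.Product using (_×_; _,_; Σ)
open import Data.Sum using (_⊎_)
open import Relation.Nullary using (¬_; Dec; yes; no)
open import Relation.Nullary.Decidable using (_×-dec_; _⊎-dec_; ¬?)
open import Relation.Binary using (Decidable; DecidableEquality)
open import Relation.Binary.PropositionalEquality using (_≡_; _≢_)

-- Finite simple graphs, given by a duplicate-free list of all vertices
-- and a decidable (symmetric, irreflexive) adjacency relation.

record FinGraph : Set₁ where
  field
    V     : Set
    _≟V_  : DecidableEquality V
    verts : List V               -- enumeration of V(G), without repetitions
    Adj   : V → V → Set
    adj?  : Decidable Adj

open FinGraph public

combinations : {A : Set} → ℕ → List A → List (List A)
combinations zero    _        = [ [] ]
combinations (suc r) []       = []
combinations (suc r) (x ∷ xs) = map (x ∷_) (combinations r xs) ++ combinations (suc r) xs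

π : ℕ → FinGraph → ℕ
π k G = length (filter (allPairs? (adj? G)) (combinations k (verts G)))

IsWeighting : (G : FinGraph) → ℕ → (V G → ℕ) → Set
IsWeighting G m w = sum (map w (verts G)) ≡ m

-- Blow-up G(w): vertex v replaced by a clique on the w(v) vertices
-- (v , 0) … (v , w v - 1); (u,i) ~ (v,j) iff (u = v and i ≠ j) or uv ∈ E(G).
blowAdj : (G : FinGraph) → V G × ℕ → V G × ℕ → Set
blowAdj G (u , i) (v , j) = (u ≡ v × i ≢ j) ⊎ Adj G u v

blowUp : (G : FinGraph) → (V G → ℕ) → FinGraph
blowUp G w = record
  { V     = V G × ℕ
  ; _≟V_  = λ { (u , i) (v , j) → pairDec (_≟V_ G u v) (i ≟ℕ j) }
  ; verts = concatMap (λ v → map (v ,_) (upTo (w v))) (verts G)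
  ; Adj   = blowAdj G
  ; adj?  = λ { (u , i) (v , j) → (_≟V_ G u v ×-dec ¬? (i ≟ℕ j)) ⊎-dec adj? G u v }
  }
  where
  open import Data.Product.Properties using (,-injective)
  open import Relation.Binary.PropositionalEquality using (refl)
  pairDec : ∀ {u v : V G} {i j : ℕ} → Dec (u ≡ v) → Dec (i ≡ j) → Dec ((u , i) ≡ (v , j))
  pairDec (yes refl) (yes refl) = yes refl
  pairDec (no ¬p)    _          = no λ { refl → ¬p refl }
  pairDec (yes _)    (no ¬q)    = no λ { refl → ¬q refl }

IsVertexSet : (G : FinGraph) → List (V G) → Set
IsVertexSet G U = Unique U × All (_∈ verts G) U

IsKCliqueIndep : (G : FinGraph) → ℕ → List (V G) → Set
IsKCliqueIndep G k I =
  IsVertexSet G I ×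
  ((S : List (V G)) → S ⊆ I → length S ≡ k → ¬ AllPairs (Adj G) S)

IsMaxKCliqueIndep : (G : FinGraph) → ℕ → List (V G) → Set
IsMaxKCliqueIndep G k I =
  IsKCliqueIndep G k I × ((J : List (V G)) → IsKCliqueIndep G k J → length J ≤ length I)

IsAlphaK : (G : FinGraph) → ℕ → ℕ → Set
IsAlphaK G k a = Σ (List (V G)) λ I → IsMaxKCliqueIndep G k I × length I ≡ a

IsIndep : (G : FinGraph) → List (V G) → Set
IsIndep G I = IsVertexSet G I × AllPairs (λ x y → ¬ Adj G x y) I

IsMaxIndep : (G : FinGraph) → List (V G) → Set
IsMaxIndep G I = IsIndep G I × ((J : List (V G)) → IsIndep G J → length J ≤ length I)

-- Uniform weightings.  For s ≥ 1: ⌊m/s⌋ = m / s and ⌈m/s⌉ = (m + s - 1) / s.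

floorDiv : ℕ → ℕ → ℕ
floorDiv m zero    = 0
floorDiv m (suc t) = m / suc t

ceilDiv : ℕ → ℕ → ℕ
ceilDiv m zero    = 0
ceilDiv m (suc t) = (m + t) / suc t

UniformOn : (G : FinGraph) → ℕ → (V G → ℕ) → List (V G) → Set
UniformOn G m w U =
  ((v : V G) → v ∉ U → w v ≡ 0) ×
  ((u : V G) → u ∈ U → (w u ≡ floorDiv m (length U)) ⊎ (w u ≡ ceilDiv m (length U)))

UniformAlpha : (G : FinGraph) → ℕ → (V G → ℕ) → Set
UniformAlpha G m w = Σ (List (V G)) λ U → IsMaxIndep G U × UniformOn G m w U

allSubsets : (n : ℕ) → List (Subset n)
allSubsets zero    = [ [] ]
allSubsets (suc n) = map (false ∷_) (allSubsets n) ++ map (true ∷_) (allSubsets n)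

SpernerAdj : {n : ℕ} → Subset n → Subset n → Set
SpernerAdj X Y = X ⊂ Y ⊎ Y ⊂ X

B : ℕ → FinGraph
B n = record
  { V     = Subset n
  ; _≟V_  = ≡-dec _≟B_
  ; verts = allSubsets n
  ; Adj   = SpernerAdj
  ; adj?  = λ X Y → (X ⊂? Y) ⊎-dec (Y ⊂? X)
  }

{-# OPTIONS --safe #-}
-- Decompose 2^[n] into symmetric chains; each contains exactly one set of size ⌊n/2⌋, so there are
-- at most α(B_n) of them.  The blow-up of a chain is a clique, so B_n(w') contains one clique for
-- each chain, of total size m, while B_n(w) is a disjoint union of α(B_n) cliques of balanced sizes
-- and total size m.  By convexity of x ↦ C(x,k) the k-cliques inside the chains of w' are already
-- at least as numerous as all those of w.  For strictness, the maximality of I provides X ⊂ Y in I with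
-- (X , Y) ≠ (∅ , [n]), and the decomposition can be chosen so that X and Y lie in different chains;
-- as X and Y have weight at least k, they span a k-clique that is in no chain.
module Submission where

open import Defs
open import Data.Bool using (Bool; true; false; not)
open import Data.Bool.Properties using (not-involutive) renaming (_≟_ to _≟B_)
open import Data.Empty using (⊥-elim)
open import Data.Fin.Subset using (Subset; _⊂_; ∁; ∣_∣; inside; outside) renaming (⊥ to ∅; ⊤ to full; _⊆_ to _⊆ˢ_)
import Data.Fin.Subset.Properties as Subset
open import Data.List using (List; []; _∷_; _++_; map; concatMap; length; filter; upTo; applyUpTo)
open import Data.List.Membership.Propositional using (_∈_; _∉_; find)
open import Data.List.Membership.Propositional.Properties using (∈-map⁺; ∈-map⁻; ∈-++⁺ˡ; ∈-++⁺ʳ; ∈-++⁻; ∈-concatMap⁻; ∈-filter⁺; ∈-filter⁻; ∈-upTo⁻)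
open import Data.List.Properties using (length-++; length-map; length-upTo; map-∘; filter-++; filter-accept; filter-reject; filter-≐; filter-none; filter-all)
open import Data.List.Relation.Binary.Disjoint.Propositional using (Disjoint)
open import Data.List.Relation.Binary.Sublist.Propositional using (_⊆_; []; _∷_; _∷ʳ_; ⊆-trans; ⊆-refl; from∈; to∈)
open import Data.List.Relation.Binary.Sublist.Propositional.Properties as Sublist using (All-resp-⊆; []⊆-universal)
open import Data.List.Relation.Unary.All as All using (All; []; _∷_; all?)
import Data.List.Relation.Unary.All.Properties as All
open import Data.List.Relation.Unary.AllPairs as AllPairs using (AllPairs; []; _∷_; allPairs?)
import Data.List.Relation.Unary.AllPairs.Properties as AllPairs
open import Data.List.Relation.Unary.Any using (here; there; any?)
open import Data.List.Relation.Unary.Unique.Propositional using (Unique)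
import Data.List.Relation.Unary.Unique.Propositional.Properties as Unique
open import Data.Nat
open import Data.Nat.Combinatorics using (_C_; nCk+nC[k+1]≡[n+1]C[k+1])
open import Data.Nat.Divisibility using (∣-refl)
open import Data.Nat.DivMod using (/-monoˡ-≤; +-distrib-/-∣ʳ; n/n≡1; m*n/n≡m)
open import Data.Nat.ListAction using (sum)
open import Data.Nat.Properties
open import Data.Nat.Solver using (module +-*-Solver)
open import Data.Product using (_×_; _,_; proj₁; proj₂; Σ; ∃)
open import Data.Sum using (_⊎_; inj₁; inj₂; swap)
open import Data.Vec using ([]; _∷_)
import Data.Vec as Vec
import Data.Vec.Properties as Vec
open import Function using (_∘_)
open import Relation.Binary using (DecidableEquality)
open import Relation.Binary.PropositionalEquality hiding (J)
open import Relation.Nullary using (¬_; Dec; yes; no; does)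
open import Relation.Nullary.Decidable using (_×-dec_; dec-true; dec-false; decidable-stable)
open import Relation.Unary using (Decidable)

private
  variable
    A K : Set
    n : ℕ

-- Symmetric chain decompositions

_≟ˢ_ : (X Y : Subset n) → Dec (X ≡ Y)
_≟ˢ_ = Vec.≡-dec _≟B_

-- chain X labels the chain through X.  The label is a set whose size is the size of the least
-- member of that chain, so the chain runs through the sizes from ∣ chain X ∣ to n − ∣ chain X ∣.
record SymmetricChains (n : ℕ) : Set where
  field
    chain  : Subset n → Subset n
    bottom : ∀ X → ∣ chain X ∣ ≤ ∣ X ∣
    top    : ∀ X → ∣ X ∣ + ∣ chain X ∣ ≤ n
    nested : ∀ X Y → chain X ≡ chain Y → ∣ X ∣ ≤ ∣ Y ∣ → X ⊆ˢ Y
    level  : ∀ X j → ∣ chain X ∣ ≤ j → j + ∣ chain X ∣ ≤ n →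
             ∃ λ Y → chain Y ≡ chain X × ∣ Y ∣ ≡ j

open SymmetricChains

∁-involutive : (X : Subset n) → ∁ (∁ X) ≡ X
∁-involutive []      = refl
∁-involutive (b ∷ X) = cong₂ _∷_ (not-involutive b) (∁-involutive X)

∁-∅ : ∁ (∅ {n}) ≡ full
∁-∅ {n} = Vec.map-replicate not outside n

∁-full : ∁ (full {n}) ≡ ∅
∁-full {n} = Vec.map-replicate not inside n

∣X∣+∣∁X∣≡n : (X : Subset n) → ∣ X ∣ + ∣ ∁ X ∣ ≡ n
∣X∣+∣∁X∣≡n X = trans (cong (∣ X ∣ +_) (Subset.∣∁p∣≡n∸∣p∣ X)) (m+[n∸m]≡n (Subset.∣p∣≤n X))

∣∁∣-antitone : (X Y : Subset n) → ∣ X ∣ ≤ ∣ Y ∣ → ∣ ∁ Y ∣ ≤ ∣ ∁ X ∣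
∣∁∣-antitone {n} X Y p =
  subst₂ _≤_ (sym (Subset.∣∁p∣≡n∸∣p∣ Y)) (sym (Subset.∣∁p∣≡n∸∣p∣ X)) (∸-monoʳ-≤ n p)

-- Complementation reverses inclusions and exchanges the sizes j and n - j, so a chain with sizes
-- from b to n - b goes to another such chain and the label of `∁ X` can be kept. In `separating`
-- this exchanges the roles of the bits 0 and 1.
complemented : SymmetricChains n → SymmetricChains n
complemented {n} D = record
  { chain  = λ X → chain D (∁ X)
  ; bottom = λ X → +-cancelˡ-≤ ∣ ∁ X ∣ _ _ (≤-trans (top D (∁ X)) (≤-reflexive
                     (trans (sym (∣X∣+∣∁X∣≡n X)) (+-comm ∣ X ∣ ∣ ∁ X ∣))))
  ; top    = λ X → ≤-trans (+-monoʳ-≤ ∣ X ∣ (bottom D (∁ X))) (≤-reflexive (∣X∣+∣∁X∣≡n X))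
  ; nested = λ X Y e p → Subset.∁p⊆∁q⇒p⊇q (nested D (∁ Y) (∁ X) (sym e) (∣∁∣-antitone X Y p))
  ; level  = lev
  }
  where
  lev : ∀ X j → ∣ chain D (∁ X) ∣ ≤ j → j + ∣ chain D (∁ X) ∣ ≤ n →
        ∃ λ Y → chain D (∁ Y) ≡ chain D (∁ X) × ∣ Y ∣ ≡ j
  lev X j lo hi with j≤n ← ≤-trans (m≤m+n j _) hi
    with level D (∁ X) (n ∸ j)
           (m+n≤o⇒n≤o∸m j hi)
           (≤-trans (+-monoʳ-≤ (n ∸ j) lo) (≤-reflexive (m∸n+n≡m j≤n)))
    where
    m+n≤o⇒n≤o∸m : ∀ a {b c} → a + b ≤ c → b ≤ c ∸ a
    m+n≤o⇒n≤o∸m a {b} {c} le = m+n≤o⇒m≤o∸n b (subst (_≤ c) (+-comm a b) le)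
  ... | Y , e , c = ∁ Y , trans (cong (chain D) (∁-involutive Y)) e ,
        trans (Subset.∣∁p∣≡n∸∣p∣ Y) (trans (cong (n ∸_) c) (m∸[m∸n]≡n j≤n))

-- The last set of a chain is the one that attains the bound in `top`; the value is `false` exactly
-- there. `extend` uses this Boolean directly as the first bit of a label.
hasAbove : SymmetricChains n → Subset n → Bool
hasAbove {n} D X = not (does (∣ X ∣ + ∣ chain D X ∣ ≟ n))

hasAbove-cases : (D : SymmetricChains n) (X : Subset n) →
                 (∣ X ∣ + ∣ chain D X ∣ ≡ n × hasAbove D X ≡ false) ⊎
                 (∣ X ∣ + ∣ chain D X ∣ < n × hasAbove D X ≡ true)
hasAbove-cases {n} D X with ∣ X ∣ + ∣ chain D X ∣ ≟ n
... | yes e = inj₁ (e , cong not (dec-true (∣ X ∣ + ∣ chain D X ∣ ≟ n) e))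
... | no ¬e = inj₂ (≤∧≢⇒< (top D X) ¬e , cong not (dec-false (∣ X ∣ + ∣ chain D X ∣ ≟ n) ¬e))

top⇒hasAbove≡false : (D : SymmetricChains n) (X : Subset n) →
                     ∣ X ∣ + ∣ chain D X ∣ ≡ n → hasAbove D X ≡ false
top⇒hasAbove≡false D X e with hasAbove-cases D X
... | inj₁ (_ , f) = f
... | inj₂ (l , _) = ⊥-elim (<⇒≢ l e)

notTop⇒hasAbove≡true : (D : SymmetricChains n) (X : Subset n) →
                       ∣ X ∣ + ∣ chain D X ∣ < n → hasAbove D X ≡ true
notTop⇒hasAbove≡true D X l with hasAbove-cases D X
... | inj₁ (e , _) = ⊥-elim (<⇒≢ l e)
... | inj₂ (_ , t) = t

-- De Bruijn's step: a chain X₁ ⊂ … ⊂ Xₗ yields 0X₁ ⊂ … ⊂ 0Xₗ ⊂ 1Xₗ and 1X₁ ⊂ … ⊂ 1Xₗ₋₁,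
-- labelled by the old label extended with 0 and 1 respectively.
extend : SymmetricChains n → SymmetricChains (suc n)
extend {n} D = record { chain = ch ; bottom = bo ; top = to ; nested = ne ; level = le }
  where
  ch : Subset (suc n) → Subset (suc n)
  ch (outside ∷ X) = outside ∷ chain D X
  ch (inside  ∷ X) = hasAbove D X ∷ chain D X

  bo : ∀ X → ∣ ch X ∣ ≤ ∣ X ∣
  bo (outside ∷ X) = bottom D X
  bo (inside  ∷ X) with hasAbove D X
  ... | false = m≤n⇒m≤1+n (bottom D X)
  ... | true  = s≤s (bottom D X)

  to : ∀ X → ∣ X ∣ + ∣ ch X ∣ ≤ suc n
  to (outside ∷ X) = m≤n⇒m≤1+n (top D X)
  to (inside  ∷ X) with hasAbove D X | hasAbove-cases D X
  ... | false | inj₁ (e , _) = s≤s (≤-reflexive e)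
  ... | true  | inj₂ (l , _) = s≤s (subst (_≤ n) (sym (+-suc ∣ X ∣ _)) l)

  same-top : ∀ X Y → chain D X ≡ chain D Y → hasAbove D Y ≡ false → ∣ X ∣ ≤ ∣ Y ∣
  same-top X Y e f with hasAbove-cases D Y
  ... | inj₁ (t , _) = +-cancelʳ-≤ ∣ chain D Y ∣ _ _
          (subst₂ _≤_ (cong (λ c → ∣ X ∣ + ∣ c ∣) e) (sym t) (top D X))
  ... | inj₂ (_ , t) with () ← trans (sym f) t

  ne : ∀ X Y → ch X ≡ ch Y → ∣ X ∣ ≤ ∣ Y ∣ → X ⊆ˢ Y
  ne (outside ∷ X) (outside ∷ Y) e p = Subset.out⊆ (nested D X Y (Vec.∷-injectiveʳ e) p)
  -- Equal labels make Y the last set of its chain. This gives ∣ X ∣ ≤ ∣ Y ∣, whereas `p` only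
  -- bounds ∣ X ∣ by ∣ Y ∣ + 1.
  ne (outside ∷ X) (inside  ∷ Y) e p = Subset.out⊆ (nested D X Y (Vec.∷-injectiveʳ e)
    (same-top X Y (Vec.∷-injectiveʳ e) (sym (Vec.∷-injectiveˡ e))))
  ne (inside  ∷ X) (outside ∷ Y) e p = ⊥-elim (<⇒≱ p
    (same-top Y X (sym (Vec.∷-injectiveʳ e)) (Vec.∷-injectiveˡ e)))
  ne (inside  ∷ X) (inside  ∷ Y) e p = Subset.in⊆in (nested D X Y (Vec.∷-injectiveʳ e) (≤-pred p))

  low : ∀ X j → ∣ chain D X ∣ ≤ j → j + ∣ chain D X ∣ ≤ suc n →
        ∃ λ Y → ch Y ≡ outside ∷ chain D X × ∣ Y ∣ ≡ j
  low X j lo hi with j + ∣ chain D X ∣ ≤? n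
  ... | yes h with Y , e , c ← level D X j lo h = outside ∷ Y , cong (outside ∷_) e , c
  ... | no ¬h with j
  ...   | zero = ⊥-elim (¬h (≤-trans (m≤n+m _ ∣ X ∣) (top D X)))
  -- This is the one size that the old chain lacks. The last set of the old chain has size i = n -
  -- b, and putting 1 in front of it gives size i + 1.
  ...   | suc i with i+b≡n ← ≤-antisym (≤-pred hi) (≤-pred (≰⇒> ¬h))
        with Y , e , c ← level D X i
               (+-cancelʳ-≤ ∣ chain D X ∣ _ _ (≤-trans (+-monoˡ-≤ _ (bottom D X)) (≤-trans (top D X) (≤-reflexive (sym i+b≡n)))))
               (≤-reflexive i+b≡n)
        = inside ∷ Y , cong₂ _∷_ (top⇒hasAbove≡false D Y (trans (cong₂ (λ a v → a + ∣ v ∣) c e) i+b≡n)) e , cong suc c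

  high : ∀ X j → suc ∣ chain D X ∣ ≤ j → j + suc ∣ chain D X ∣ ≤ suc n →
         ∃ λ Y → ch Y ≡ inside ∷ chain D X × ∣ Y ∣ ≡ j
  -- The chain of the sets 1Y stops one short: i + b < n, so the Y of size i is not the last of its
  -- chain and 1Y gets the first bit `inside`.
  high X (suc i) lo hi with i+b<n ← subst (_≤ n) (+-suc i _) (≤-pred hi)
    with Y , e , c ← level D X i (≤-pred lo) (<⇒≤ i+b<n)
    = inside ∷ Y , cong₂ _∷_ (notTop⇒hasAbove≡true D Y (subst (_< n) (sym (cong₂ (λ a v → a + ∣ v ∣) c e)) i+b<n)) e , cong suc c

  le : ∀ X j → ∣ ch X ∣ ≤ j → j + ∣ ch X ∣ ≤ suc n → ∃ λ Y → ch Y ≡ ch X × ∣ Y ∣ ≡ j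
  le (outside ∷ X) = low X
  le (inside  ∷ X) with hasAbove D X
  ... | false = low X
  ... | true  = high X

symmetricChains : ∀ n → SymmetricChains n
symmetricChains zero = record
  { chain  = λ X → X
  ; bottom = λ X → ≤-refl
  ; top    = λ { [] → z≤n }
  ; nested = λ { [] [] _ _ → λ z → z }
  ; level  = λ { [] zero _ _ → [] , refl , refl }
  }
symmetricChains (suc n) = extend (symmetricChains n)

-- Decompositions that separate a given comparable pair

tails≢⇒chains≢ : (D : SymmetricChains n) (x y : Bool) {X Y : Subset n} →
            chain D X ≢ chain D Y → chain (extend D) (x ∷ X) ≢ chain (extend D) (y ∷ Y)
tails≢⇒chains≢ D false false ≢ = ≢ ∘ Vec.∷-injectiveʳ
tails≢⇒chains≢ D false true  ≢ = ≢ ∘ Vec.∷-injectiveʳ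
tails≢⇒chains≢ D true  false ≢ = ≢ ∘ Vec.∷-injectiveʳ
tails≢⇒chains≢ D true  true  ≢ = ≢ ∘ Vec.∷-injectiveʳ

-- 0X is never the last set of its chain, so the second step separates 00X from 10X.
extend²-separates : (D : SymmetricChains n) (X : Subset n) →
  chain (extend (extend D)) (outside ∷ outside ∷ X) ≢ chain (extend (extend D)) (inside ∷ outside ∷ X)
extend²-separates D X e
  with () ← trans (Vec.∷-injectiveˡ e) (notTop⇒hasAbove≡true (extend D) (outside ∷ X) (s≤s (top D X)))

-- In positive dimension `full` is the last set of its chain and `∅` is not, so the first bits of
-- the two new labels differ.
extend-separates : (D : SymmetricChains (suc n)) →
  chain (extend D) (inside ∷ ∅) ≢ chain (extend D) (inside ∷ full)
extend-separates {n} D e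
  with () ← trans (sym (notTop⇒hasAbove≡true D ∅ (s≤s (≤-trans
                          (+-mono-≤ (≤-reflexive (Subset.∣⊥∣≡0 (suc n)))
                            (≤-trans (bottom D ∅) (≤-reflexive (Subset.∣⊥∣≡0 (suc n))))) z≤n))))
            (trans (Vec.∷-injectiveˡ e)
              (top⇒hasAbove≡false D full (≤-antisym (top D full)
                (≤-trans (≤-reflexive (sym (Subset.∣⊤∣≡n (suc n)))) (m≤m+n _ _)))))

⊆∧≢⇒⊂ : (X Y : Subset n) → X ⊆ˢ Y → X ≢ Y → X ⊂ Y
⊆∧≢⇒⊂ []            []            _ ≢ = ⊥-elim (≢ refl)
⊆∧≢⇒⊂ (outside ∷ X) (outside ∷ Y) s ≢ = Subset.out⊂ (⊆∧≢⇒⊂ X Y (Subset.drop-∷-⊆ s) (≢ ∘ cong (outside ∷_)))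
⊆∧≢⇒⊂ (outside ∷ X) (inside  ∷ Y) s ≢ = Subset.out⊂in (Subset.drop-∷-⊆ s)
⊆∧≢⇒⊂ (inside  ∷ X) (outside ∷ Y) s ≢ with () ← s Vec.here
⊆∧≢⇒⊂ (inside  ∷ X) (inside  ∷ Y) s ≢ = Subset.in⊂in (⊆∧≢⇒⊂ X Y (Subset.drop-∷-⊆ s) (≢ ∘ cong (inside ∷_)))

-- Induction on n. If the tails differ and are not the pair (∅, full), a decomposition separating
-- the tails is extended, because the tail of a new label is the old label. Equal tails and extreme
-- tails are separated by de Bruijn's step itself, up to complementation.
separating : (X Y : Subset n) → X ⊂ Y → ¬ (X ≡ ∅ × Y ≡ full) →
             Σ (SymmetricChains n) λ D → chain D X ≢ chain D Y
separating [] [] (_ , () , _) _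
separating (x ∷ X) (y ∷ Y) X⊂Y@(s , _) ¬ext with X ≟ˢ Y
separating (false ∷ X) (false ∷ X) X⊂Y ¬ext | yes refl = ⊥-elim (Subset.⊂-irref refl X⊂Y)
separating (true  ∷ X) (true  ∷ X) X⊂Y ¬ext | yes refl = ⊥-elim (Subset.⊂-irref refl X⊂Y)
separating (true  ∷ X) (false ∷ X) (s , _) ¬ext | yes refl with () ← s Vec.here
separating (false ∷ [])        (true ∷ []) _ ¬ext | yes refl = ⊥-elim (¬ext (refl , refl))
separating (false ∷ false ∷ X) (true ∷ _) _ _ | yes refl =
  extend (extend (symmetricChains _)) , extend²-separates (symmetricChains _) X
-- The complements of 01X and 11X have the form 10Z and 00Z with Z = `∁ X`, which is the previous
-- case reversed.
separating (false ∷ true ∷ X)  (true ∷ _) _ _ | yes refl =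
  complemented (extend (extend (symmetricChains _))) , extend²-separates (symmetricChains _) (∁ X) ∘ sym
separating (x ∷ X) (y ∷ Y) X⊂Y@(s , _) ¬ext | no X≢Y with (X ≟ˢ ∅) ×-dec (Y ≟ˢ full)
... | no ¬ext′ with D , ≢ ← separating X Y (⊆∧≢⇒⊂ X Y (Subset.drop-∷-⊆ s) X≢Y) ¬ext′ =
  extend D , tails≢⇒chains≢ D x y ≢
separating {suc zero} (x ∷ []) (y ∷ []) _ ¬ext | no X≢Y | yes _ = ⊥-elim (X≢Y refl)
separating {suc (suc n)} (false ∷ X) (true ∷ Y) _ ¬ext | no _ | yes (refl , refl) = ⊥-elim (¬ext (refl , refl))
separating {suc (suc n)} (true ∷ X) (false ∷ Y) (s , _) ¬ext | no _ | yes (refl , refl) with () ← s Vec.here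
separating {suc (suc n)} (true ∷ X) (true ∷ Y) _ ¬ext | no _ | yes (refl , refl) =
  extend (symmetricChains _) , extend-separates (symmetricChains (suc n))
-- The complements of 0∅ and 0full are 1full and 1∅, the pair of the previous case in reverse order.
separating {suc (suc n)} (false ∷ X) (false ∷ Y) _ ¬ext | no _ | yes (refl , refl) =
  complemented (extend (symmetricChains _)) ,
  λ e → extend-separates (symmetricChains (suc n))
          (sym (subst₂ (λ A B → chain (extend (symmetricChains (suc n))) (inside ∷ A) ≡ chain (extend (symmetricChains (suc n))) (inside ∷ B)) ∁-∅ ∁-full e))

-- Counting monochromatic combinations

combinations⇒⊆ : ∀ k (xs : List A) {S} → S ∈ combinations k xs → S ⊆ xs
combinations⇒⊆ zero    xs       (here refl) = []⊆-universal xs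
combinations⇒⊆ (suc k) (x ∷ xs) S∈ with ∈-++⁻ (map (x ∷_) (combinations k xs)) S∈
... | inj₁ S∈ˡ with _ , T∈ , refl ← ∈-map⁻ (x ∷_) S∈ˡ = refl ∷ combinations⇒⊆ k xs T∈
... | inj₂ S∈ʳ = x ∷ʳ combinations⇒⊆ (suc k) xs S∈ʳ

⊆⇒combinations : {S xs : List A} → S ⊆ xs → S ∈ combinations (length S) xs
⊆⇒combinations {S = []}    _          = here refl
⊆⇒combinations {S = _ ∷ S} (y ∷ʳ τ)   = ∈-++⁺ʳ (map (y ∷_) (combinations (length S) _)) (⊆⇒combinations τ)
⊆⇒combinations {S = _ ∷ _} (refl ∷ τ) = ∈-++⁺ˡ (∈-map⁺ (_ ∷_) (⊆⇒combinations τ))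

AllPairs-resp-⊆ : {R : A → A → Set} {xs ys : List A} → xs ⊆ ys → AllPairs R ys → AllPairs R xs
AllPairs-resp-⊆ []         []         = []
AllPairs-resp-⊆ (_ ∷ʳ τ)   (_ ∷ ps)   = AllPairs-resp-⊆ τ ps
AllPairs-resp-⊆ (refl ∷ τ) (p ∷ ps)   = All-resp-⊆ τ p ∷ AllPairs-resp-⊆ τ ps

module _ {P Q : A → Set} (P? : Decidable P) (Q? : Decidable Q) where

  length-filter-mono : ∀ xs → (∀ {x} → x ∈ xs → P x → Q x) →
                       length (filter P? xs) ≤ length (filter Q? xs)
  length-filter-mono []       _   = z≤n
  length-filter-mono (x ∷ xs) P⇒Q with ih ← length-filter-mono xs (P⇒Q ∘ there) | P? x | Q? x
  ... | yes _  | yes _  = s≤s ih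
  ... | yes px | no ¬qx = ⊥-elim (¬qx (P⇒Q (here refl) px))
  ... | no _   | yes _  = m≤n⇒m≤1+n ih
  ... | no _   | no _   = ih

  length-filter-mono-< : ∀ xs → (∀ {x} → x ∈ xs → P x → Q x) →
                         ∀ {y} → y ∈ xs → Q y → ¬ P y →
                         length (filter P? xs) < length (filter Q? xs)
  length-filter-mono-< (x ∷ xs) P⇒Q (here refl) qy ¬py
    with ih ← length-filter-mono xs (P⇒Q ∘ there) | P? x | Q? x
  ... | yes py | _      = ⊥-elim (¬py py)
  ... | no _   | yes _  = s≤s ih
  ... | no _   | no ¬qy = ⊥-elim (¬qy qy)
  length-filter-mono-< (x ∷ xs) P⇒Q (there y∈) qy ¬py
    with ih ← length-filter-mono-< xs (P⇒Q ∘ there) y∈ qy ¬py | P? x | Q? x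
  ... | yes _  | yes _  = s≤s ih
  ... | yes px | no ¬qx = ⊥-elim (¬qx (P⇒Q (here refl) px))
  ... | no _   | yes _  = m≤n⇒m≤1+n ih
  ... | no _   | no _   = ih

length-filter-map : {P : A → Set} (P? : Decidable P) (f : K → A) (xs : List K) →
                    length (filter P? (map f xs)) ≡ length (filter (P? ∘ f) xs)
length-filter-map P? f []       = refl
length-filter-map P? f (x ∷ xs) with ih ← length-filter-map P? f xs | P? (f x)
... | yes _ = cong suc ih
... | no  _ = ih

length-filter-combinations-∷ : {P : List A → Set} (P? : Decidable P) (k : ℕ) (x : A) (xs : List A) →
  length (filter P? (combinations (suc k) (x ∷ xs))) ≡
  length (filter (P? ∘ (x ∷_)) (combinations k xs)) + length (filter P? (combinations (suc k) xs))
length-filter-combinations-∷ P? k x xs = trans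
  (cong length (filter-++ P? (map (x ∷_) (combinations k xs)) (combinations (suc k) xs)))
  (trans (length-++ (filter P? (map (x ∷_) (combinations k xs))))
         (cong (_+ _) (length-filter-map P? (x ∷_) (combinations k xs))))

combinations-All : {P : A → Set} (P? : Decidable P) (k : ℕ) (xs : List A) →
                   length (filter (all? P?) (combinations k xs)) ≡ length (filter P? xs) C k
combinations-All P? zero    xs = refl
combinations-All P? (suc k) [] = refl
combinations-All P? (suc k) (x ∷ xs) with combinations-All P? k xs | combinations-All P? (suc k) xs | P? x
... | ih₁ | ih₂ | yes px = trans (length-filter-combinations-∷ (all? P?) k x xs)
  (trans (cong₂ _+_
            (trans (cong length (filter-≐ (all? P? ∘ (x ∷_)) (all? P?) (All.tail , (px ∷_)) (combinations k xs))) ih₁)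
            ih₂)
    (nCk+nC[k+1]≡[n+1]C[k+1] (length (filter P? xs)) k))
... | ih₁ | ih₂ | no ¬px = trans (length-filter-combinations-∷ (all? P?) k x xs)
  (cong₂ _+_ (cong length (filter-none (all? P? ∘ (x ∷_))
               (All.universal (λ _ → ¬px ∘ All.head) (combinations k xs)))) ih₂)

sum-map-cong : {g h : K → ℕ} (κs : List K) → (∀ {κ} → κ ∈ κs → g κ ≡ h κ) → sum (map g κs) ≡ sum (map h κs)
sum-map-cong []       _  = refl
sum-map-cong (κ ∷ κs) eq = cong₂ _+_ (eq (here refl)) (sum-map-cong κs (eq ∘ there))

-- Adding an element to a list changes the contribution of its own colour class only; `Unique κs`
-- ensures that this class is met once.
sum-map-update : {g h : K → ℕ} {κ₀ : K} {c : ℕ} (κs : List K) → Unique κs → κ₀ ∈ κs →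
                 g κ₀ ≡ c + h κ₀ → (∀ κ → κ₀ ≢ κ → g κ ≡ h κ) →
                 sum (map g κs) ≡ c + sum (map h κs)
sum-map-update {g = g} {h} {κ₀} {c} (κ ∷ κs) (κ∉ ∷ _) (here refl) at off = trans
  (cong₂ _+_ at (sum-map-cong κs (λ κ′∈ → off _ (All.lookup κ∉ κ′∈))))
  (+-assoc c (h κ₀) _)
sum-map-update {g = g} {h} {κ₀} {c} (κ ∷ κs) (κ∉ ∷ κs!) (there κ₀∈) at off = trans
  (cong₂ _+_ (off κ (λ e → All.lookup κ∉ κ₀∈ (sym e))) (sum-map-update κs κs! κ₀∈ at off))
  (trans (sym (+-assoc (h κ) c _)) (trans (cong (_+ sum (map h κs)) (+-comm (h κ) c)) (+-assoc c (h κ) _)))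

-- Applied to the vertices of a blow-up in two ways: coloured by the vertex of the graph that they
-- replace, and by the chain of that vertex.
module Colouring (_≟_ : DecidableEquality K) (f : A → K) where

  classSize : List A → K → ℕ
  classSize xs κ = length (filter (λ x → f x ≟ κ) xs)

  monochromatic? : Decidable (AllPairs (λ x y → f x ≡ f y))
  monochromatic? = allPairs? (λ x y → f x ≟ f y)

  classSize-same : ∀ x xs → classSize (x ∷ xs) (f x) ≡ suc (classSize xs (f x))
  classSize-same x xs = cong length (filter-accept (λ y → f y ≟ f x) {xs = xs} refl)

  classSize-other : ∀ x xs κ → f x ≢ κ → classSize (x ∷ xs) κ ≡ classSize xs κ
  classSize-other x xs κ ≢ = cong length (filter-reject (λ y → f y ≟ κ) {xs = xs} ≢)

  module _ {κs : List K} (κs! : Unique κs) where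

    sum-classSizes : ∀ xs → All (λ x → f x ∈ κs) xs → sum (map (classSize xs) κs) ≡ length xs
    sum-classSizes []       []       = sum-zeros κs
      where
      sum-zeros : ∀ κs → sum (map (classSize []) κs) ≡ 0
      sum-zeros []       = refl
      sum-zeros (_ ∷ κs) = sum-zeros κs
    sum-classSizes (x ∷ xs) (c ∷ cs) = trans
      (sum-map-update κs κs! c (classSize-same x xs) (classSize-other x xs))
      (cong suc (sum-classSizes xs cs))

    -- The monochromatic combinations through the head x consist of x and k further elements of its
    -- class, so Pascal's rule updates the term of that class. The size is `suc k` because the empty
    -- combination would be counted once for every class on the right.
    count-monochromatic : ∀ k xs → All (λ x → f x ∈ κs) xs →
      length (filter monochromatic? (combinations (suc k) xs)) ≡ sum (map (λ κ → classSize xs κ C suc k) κs)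
    count-monochromatic k []       []       = sum-zeros κs
      where
      sum-zeros : ∀ κs → 0 ≡ sum (map (λ κ → classSize [] κ C suc k) κs)
      sum-zeros []       = refl
      sum-zeros (_ ∷ κs) = sum-zeros κs
    count-monochromatic k (x ∷ xs) (c ∷ cs) = trans
      (length-filter-combinations-∷ monochromatic? k x xs)
      (trans (cong₂ _+_
               (trans (cong length (filter-≐ (monochromatic? ∘ (x ∷_)) (all? (λ y → f y ≟ f x))
                                      (fwd , bwd) (combinations k xs)))
                      (combinations-All (λ y → f y ≟ f x) k xs))
               (count-monochromatic k xs cs))
        (sym (sum-map-update κs κs! c
          (trans (cong (_C suc k) (classSize-same x xs)) (sym (nCk+nC[k+1]≡[n+1]C[k+1] _ k)))
          (λ κ ≢ → cong (_C suc k) (classSize-other x xs κ ≢)))))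
      where
      fwd : ∀ {S} → AllPairs (λ y z → f y ≡ f z) (x ∷ S) → All (λ y → f y ≡ f x) S
      fwd (p ∷ _) = All.map sym p
      all⇒pairs : ∀ {S} → All (λ y → f y ≡ f x) S → AllPairs (λ y z → f y ≡ f z) S
      all⇒pairs []       = []
      all⇒pairs (p ∷ ps) = All.map (λ q → trans p (sym q)) ps ∷ all⇒pairs ps
      bwd : ∀ {S} → All (λ y → f y ≡ f x) S → AllPairs (λ y z → f y ≡ f z) (x ∷ S)
      bwd ps = All.map sym ps ∷ all⇒pairs ps

-- Convexity of binomial coefficients

m≤n⇒∃[o]o+m≡n : ∀ {m n} → m ≤ n → ∃ λ o → o + m ≡ n
m≤n⇒∃[o]o+m≡n m≤n = _ , m∸n+n≡m m≤n

C-step : ∀ q k → q C k ≤ suc q C k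
C-step q zero    = ≤-refl
C-step q (suc k) = ≤-trans (m≤n+m _ (q C k)) (≤-reflexive (nCk+nC[k+1]≡[n+1]C[k+1] q k))

C-mono : ∀ q d k → q C k ≤ (d + q) C k
C-mono q zero    k = ≤-refl
C-mono q (suc d) k = ≤-trans (C-mono q d k) (C-step (d + q) k)

-- By Pascal's rule, each of the d unit steps upwards from q adds at least C(q,k).
C-above : ∀ q d k → q C suc k + d * (q C k) ≤ (d + q) C suc k
C-above q zero    k = ≤-reflexive (+-identityʳ _)
C-above q (suc d) k = begin
  q C suc k + (q C k + d * (q C k)) ≡⟨ solve 3 (λ a b c → a :+ (b :+ c) := b :+ (a :+ c)) refl (q C suc k) (q C k) (d * (q C k)) ⟩
  q C k + (q C suc k + d * (q C k)) ≤⟨ +-mono-≤ (C-mono q d k) (C-above q d k) ⟩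
  (d + q) C k + (d + q) C suc k     ≡⟨ nCk+nC[k+1]≡[n+1]C[k+1] (d + q) k ⟩
  (suc d + q) C suc k               ∎
  where open ≤-Reasoning
        open +-*-Solver

-- Each of the d unit steps from x up to d + x adds at most C(d + x,k).
C-below : ∀ x d k → (d + x) C suc k ≤ x C suc k + d * ((d + x) C k)
C-below x zero    k = m≤m+n _ _
C-below x (suc d) k = begin
  (suc d + x) C suc k                                 ≡⟨ nCk+nC[k+1]≡[n+1]C[k+1] (d + x) k ⟨
  (d + x) C k + (d + x) C suc k                       ≤⟨ +-monoʳ-≤ ((d + x) C k) (C-below x d k) ⟩
  (d + x) C k + (x C suc k + d * ((d + x) C k))       ≡⟨ solve 3 (λ a b c → a :+ (b :+ c :* a) := b :+ (con 1 :+ c) :* a) refl ((d + x) C k) (x C suc k) d ⟩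
  x C suc k + suc d * ((d + x) C k)                   ≤⟨ +-monoʳ-≤ (x C suc k) (*-monoʳ-≤ (suc d) (C-step (d + x) k)) ⟩
  x C suc k + suc d * ((suc d + x) C k)               ∎
  where open ≤-Reasoning
        open +-*-Solver

-- C(x,k+1) lies above the line through its values at q and q+1 (slope C(q,k));
-- the terms are moved so that no subtraction occurs.
C-tangent : ∀ x q k → q C suc k + x * (q C k) ≤ x C suc k + q * (q C k)
C-tangent x q k with ≤-total q x
... | inj₁ q≤x with d , refl ← m≤n⇒∃[o]o+m≡n q≤x = begin
  q C suc k + (d + q) * (q C k)           ≡⟨ solve 4 (λ a d q c → a :+ (d :+ q) :* c := (a :+ d :* c) :+ q :* c) refl (q C suc k) d q (q C k) ⟩
  q C suc k + d * (q C k) + q * (q C k)   ≤⟨ +-monoˡ-≤ _ (C-above q d k) ⟩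
  (d + q) C suc k + q * (q C k)           ∎
  where open ≤-Reasoning
        open +-*-Solver
... | inj₂ x≤q with d , refl ← m≤n⇒∃[o]o+m≡n x≤q = begin
  q C suc k + x * (q C k)                 ≤⟨ +-monoˡ-≤ _ (C-below x d k) ⟩
  x C suc k + d * (q C k) + x * (q C k)   ≡⟨ solve 4 (λ a d x c → (a :+ d :* c) :+ x :* c := a :+ (d :+ x) :* c) refl (x C suc k) d x (q C k) ⟩
  x C suc k + (d + x) * (q C k)           ∎
  where open ≤-Reasoning
        open +-*-Solver

C-tangent-≡ : ∀ x q k → x ≡ q ⊎ x ≡ suc q → x C suc k + q * (q C k) ≡ q C suc k + x * (q C k)
C-tangent-≡ x q k (inj₁ refl) = refl
C-tangent-≡ x q k (inj₂ refl) = trans (cong (_+ q * (q C k)) (sym (nCk+nC[k+1]≡[n+1]C[k+1] q k)))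
  (solve 3 (λ a b c → (a :+ b) :+ c := b :+ (a :+ c)) refl (q C k) (q C suc k) (q * (q C k)))
  where open +-*-Solver

module _ (k q : ℕ) where

  private
    Σᶜ : List ℕ → ℕ
    Σᶜ xs = sum (map (_C suc k) xs)
    c = q C k
    a = q C suc k

  sum-tangent : ∀ ys → length ys * a + sum ys * c ≤ Σᶜ ys + length ys * (q * c)
  sum-tangent []       = z≤n
  sum-tangent (y ∷ ys) = begin
    (a + length ys * a) + (y + sum ys) * c             ≡⟨ solve 5 (λ a la y s c → (a :+ la) :+ (y :+ s) :* c := (a :+ y :* c) :+ (la :+ s :* c)) refl a (length ys * a) y (sum ys) c ⟩
    (a + y * c) + (length ys * a + sum ys * c)         ≤⟨ +-mono-≤ (C-tangent y q k) (sum-tangent ys) ⟩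
    (y C suc k + q * c) + (Σᶜ ys + length ys * (q * c)) ≡⟨ solve 4 (λ a b c d → (a :+ b) :+ (c :+ d) := (a :+ c) :+ (b :+ d)) refl (y C suc k) (q * c) (Σᶜ ys) (length ys * (q * c)) ⟩
    (y C suc k + Σᶜ ys) + (q * c + length ys * (q * c)) ∎
    where open ≤-Reasoning
          open +-*-Solver

  sum-tangent-≡ : ∀ xs → All (λ x → x ≡ q ⊎ x ≡ suc q) xs →
                  Σᶜ xs + length xs * (q * c) ≡ length xs * a + sum xs * c
  sum-tangent-≡ []       []       = refl
  sum-tangent-≡ (x ∷ xs) (p ∷ ps) = begin
    (x C suc k + Σᶜ xs) + (q * c + length xs * (q * c)) ≡⟨ solve 4 (λ a b c d → (a :+ c) :+ (b :+ d) := (a :+ b) :+ (c :+ d)) refl (x C suc k) (q * c) (Σᶜ xs) (length xs * (q * c)) ⟩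
    (x C suc k + q * c) + (Σᶜ xs + length xs * (q * c)) ≡⟨ cong₂ _+_ (C-tangent-≡ x q k p) (sum-tangent-≡ xs ps) ⟩
    (a + x * c) + (length xs * a + sum xs * c)         ≡⟨ solve 5 (λ a la y s c → (a :+ y :* c) :+ (la :+ s :* c) := (a :+ la) :+ (y :+ s) :* c) refl a (length xs * a) x (sum xs) c ⟩
    (a + length xs * a) + (x + sum xs) * c             ∎
    where open ≡-Reasoning
          open +-*-Solver

  -- The tangent inequality at q is summed over `ys`; over the balanced list `xs` it is an equality.
  -- Since the totals agree, the linear terms cancel, and a shorter `ys` is treated as if padded
  -- with zeros.
  balanced-minimises-ΣC : ∀ xs ys → All (λ x → x ≡ q ⊎ x ≡ suc q) xs → sum xs ≡ sum ys →
                          length ys ≤ length xs → Σᶜ xs ≤ Σᶜ ys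
  balanced-minimises-ΣC xs ys bal eq le with p , p+ly≡lx ← m≤n⇒∃[o]o+m≡n le = +-cancelʳ-≤ (length xs * (q * c)) _ _ (begin
    Σᶜ xs + length xs * (q * c)                  ≡⟨ sum-tangent-≡ xs bal ⟩
    length xs * a + sum xs * c                   ≡⟨ cong₂ (λ l s → l * a + s * c) (sym p+ly≡lx) eq ⟩
    (p + length ys) * a + sum ys * c             ≡⟨ solve 4 (λ p l a s → (p :+ l) :* a :+ s := p :* a :+ (l :* a :+ s)) refl p (length ys) a (sum ys * c) ⟩
    p * a + (length ys * a + sum ys * c)         ≤⟨ +-mono-≤ (*-monoʳ-≤ p a≤qc) (sum-tangent ys) ⟩
    p * (q * c) + (Σᶜ ys + length ys * (q * c))  ≡⟨ solve 4 (λ p l e s → p :* e :+ (s :+ l :* e) := s :+ (p :+ l) :* e) refl p (length ys) (q * c) (Σᶜ ys) ⟩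
    Σᶜ ys + (p + length ys) * (q * c)            ≡⟨ cong (λ l → Σᶜ ys + l * (q * c)) p+ly≡lx ⟩
    Σᶜ ys + length xs * (q * c)                  ∎)
    where
    open ≤-Reasoning
    open +-*-Solver
    -- The tangent line is at most C(0,k+1) = 0 at x = 0, which pays for the p missing entries of
    -- `ys`.
    a≤qc : a ≤ q * c
    a≤qc = ≤-trans (≤-reflexive (sym (+-identityʳ a))) (C-tangent 0 q k)

-- Blow-ups

AllPairs-lookup : {R : A → A → Set} → (∀ x → R x x) → (∀ {x y} → R x y → R y x) →
                  {xs : List A} → AllPairs R xs → ∀ {x y} → x ∈ xs → y ∈ xs → R x y
AllPairs-lookup r s (p ∷ ps) (here refl) (here refl) = r _
AllPairs-lookup r s (p ∷ ps) (here refl) (there y∈)  = All.lookup p y∈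
AllPairs-lookup r s (p ∷ ps) (there x∈)  (here refl) = s (All.lookup p x∈)
AllPairs-lookup r s (p ∷ ps) (there x∈)  (there y∈)  = AllPairs-lookup r s ps x∈ y∈

AllPairs-mapWith : {P : A → Set} {R Q : A → A → Set} → (∀ {x y} → P x → P y → R x y → Q x y) →
                   {xs : List A} → All P xs → AllPairs R xs → AllPairs Q xs
AllPairs-mapWith f []       []         = []
AllPairs-mapWith f (p ∷ ps) (rs ∷ rss) = All.zipWith (λ (p′ , r) → f p p′ r) (ps , rs) ∷ AllPairs-mapWith f ps rss

-- Cliques are counted as sublists of a fixed enumeration, so it matters which of two vertices is
-- listed first.
pair-⊆ : {x y : A} {xs : List A} → x ∈ xs → y ∈ xs → x ≢ y → (x ∷ y ∷ [] ⊆ xs) ⊎ (y ∷ x ∷ [] ⊆ xs)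
pair-⊆ (here refl) (here refl) ≢ = ⊥-elim (≢ refl)
pair-⊆ (here refl) (there y∈)  ≢ = inj₁ (refl ∷ from∈ y∈)
pair-⊆ (there x∈)  (here refl) ≢ = inj₂ (refl ∷ from∈ x∈)
pair-⊆ (there x∈)  (there y∈)  ≢ with pair-⊆ x∈ y∈ ≢
... | inj₁ τ = inj₁ (_ ∷ʳ τ)
... | inj₂ τ = inj₂ (_ ∷ʳ τ)

concatMap-⊆ : (f : A → List K) {xs ys : List A} → xs ⊆ ys → concatMap f xs ⊆ concatMap f ys
concatMap-⊆ f []         = []
concatMap-⊆ f (y ∷ʳ τ)   = Sublist.++⁺ˡ (f y) (concatMap-⊆ f τ)
concatMap-⊆ f (refl ∷ τ) = Sublist.++⁺ ⊆-refl (concatMap-⊆ f τ)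

applyUpTo-⊆ : (f : ℕ → A) {i j : ℕ} → i ≤ j → applyUpTo f i ⊆ applyUpTo f j
applyUpTo-⊆ f z≤n     = []⊆-universal _
applyUpTo-⊆ f (s≤s p) = refl ∷ applyUpTo-⊆ (f ∘ suc) p

module Blocks (_≟_ : DecidableEquality K) (w : K → ℕ) where

  block : K → List (K × ℕ)
  block v = map (v ,_) (upTo (w v))

  -- On `verts G` this is, by computation, the vertex list of `blowUp G w`.
  blocks : List K → List (K × ℕ)
  blocks = concatMap block

  length-block : ∀ v → length (block v) ≡ w v
  length-block v = trans (length-map _ (upTo (w v))) (length-upTo (w v))

  length-blocks : ∀ vs → length (blocks vs) ≡ sum (map w vs)
  length-blocks []       = refl
  length-blocks (v ∷ vs) = trans (length-++ (block v)) (cong₂ _+_ (length-block v) (length-blocks vs))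

  ∈-block⁻ : ∀ {v x} → x ∈ block v → proj₁ x ≡ v × proj₂ x < w v
  ∈-block⁻ x∈ with _ , i∈ , refl ← ∈-map⁻ _ x∈ = refl , ∈-upTo⁻ i∈

  ∈-blocks⁻ : ∀ vs {x} → x ∈ blocks vs → proj₁ x ∈ vs × proj₂ x < w (proj₁ x)
  ∈-blocks⁻ vs x∈ with v , v∈ , x∈v ← find (∈-concatMap⁻ block {xs = vs} x∈)
    with refl , i< ← ∈-block⁻ x∈v = v∈ , i<

  blocks-unique : ∀ {vs} → Unique vs → Unique (blocks vs)
  blocks-unique []         = []
  blocks-unique {v ∷ vs} (v∉ ∷ vs!) = Unique.++⁺
    (Unique.map⁺ (cong proj₂) (Unique.upTo⁺ (w v)))
    (blocks-unique vs!)
    (λ (x∈v , x∈vs) → All.lookup v∉ (proj₁ (∈-blocks⁻ vs x∈vs)) (sym (proj₁ (∈-block⁻ x∈v))))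

  open Colouring {A = K × ℕ} _≟_ proj₁

  classSize-++ : ∀ xs ys u → classSize (xs ++ ys) u ≡ classSize xs u + classSize ys u
  classSize-++ xs ys u = trans (cong length (filter-++ (λ x → proj₁ x ≟ u) xs ys)) (length-++ (filter (λ x → proj₁ x ≟ u) xs))

  classSize-absent : ∀ xs u → (∀ {x} → x ∈ xs → proj₁ x ≢ u) → classSize xs u ≡ 0
  classSize-absent xs u ∉ = cong length (filter-none (λ x → proj₁ x ≟ u) (All.tabulate ∉))

  classSize-blocks : ∀ {vs} → Unique vs → ∀ {u} → u ∈ vs → classSize (blocks vs) u ≡ w u
  classSize-blocks {v ∷ vs} (v∉ ∷ _) {u} (here refl) = trans (classSize-++ (block u) (blocks vs) u)
    (trans (cong₂ _+_
      (trans (cong length (filter-all (λ x → proj₁ x ≟ u) (All.tabulate (proj₁ ∘ ∈-block⁻)))) (length-block u))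
      (classSize-absent (blocks vs) u (λ x∈ e → All.lookup v∉ (proj₁ (∈-blocks⁻ vs x∈)) (sym e))))
      (+-identityʳ (w u)))
  classSize-blocks {v ∷ vs} (v∉ ∷ vs!) {u} (there u∈) = trans (classSize-++ (block v) (blocks vs) u)
    (cong₂ _+_
      (classSize-absent (block v) u (λ x∈ e → All.lookup v∉ u∈ (trans (sym (proj₁ (∈-block⁻ x∈))) e)))
      (classSize-blocks vs! u∈))

-- The Sperner graph and its middle layer

allSubsets-complete : (X : Subset n) → X ∈ allSubsets n
allSubsets-complete []          = here refl
allSubsets-complete (false ∷ X) = ∈-++⁺ˡ (∈-map⁺ _ (allSubsets-complete X))
allSubsets-complete (true ∷ X)  = ∈-++⁺ʳ (map (false ∷_) (allSubsets _)) (∈-map⁺ _ (allSubsets-complete X))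

allSubsets-unique : ∀ n → Unique (allSubsets n)
allSubsets-unique zero    = [] ∷ []
allSubsets-unique (suc n) = Unique.++⁺
  (Unique.map⁺ Vec.∷-injectiveʳ (allSubsets-unique n))
  (Unique.map⁺ Vec.∷-injectiveʳ (allSubsets-unique n))
  disjoint
  where
  disjoint : Disjoint (map (false ∷_) (allSubsets n)) (map (true ∷_) (allSubsets n))
  disjoint (p , q) with _ , _ , refl ← ∈-map⁻ _ p with _ , _ , () ← ∈-map⁻ _ q

SpernerAdj-irrefl : (X : Subset n) → ¬ SpernerAdj X X
SpernerAdj-irrefl X (inj₁ p) = Subset.⊂-irref refl p
SpernerAdj-irrefl X (inj₂ p) = Subset.⊂-irref refl p

-- Chains are renamed by their members of size ⌊n/2⌋, which exist because a least size b with b + b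
-- ≤ n satisfies b ≤ ⌊n/2⌋ ≤ n - b. The colours of the count then form an independent set, whose
-- size is at most α.
module Middle (D : SymmetricChains n) where
  private
    b+b≤n : ∀ X → ∣ chain D X ∣ + ∣ chain D X ∣ ≤ n
    b+b≤n X = ≤-trans (+-monoˡ-≤ ∣ chain D X ∣ (bottom D X)) (top D X)

    b≤n/2 : ∀ X → ∣ chain D X ∣ ≤ ⌊ n /2⌋
    b≤n/2 X = ≤-trans (≤-reflexive (n≡⌊n+n/2⌋ ∣ chain D X ∣)) (⌊n/2⌋-mono (b+b≤n X))

    n/2+b≤n : ∀ X → ⌊ n /2⌋ + ∣ chain D X ∣ ≤ n
    n/2+b≤n X = ≤-trans (+-monoʳ-≤ ⌊ n /2⌋ (≤-trans (b≤n/2 X) (⌊n/2⌋≤⌈n/2⌉ n)))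
                        (≤-reflexive (⌊n/2⌋+⌈n/2⌉≡n n))

    middle-level : ∀ X → ∃ λ Y → chain D Y ≡ chain D X × ∣ Y ∣ ≡ ⌊ n /2⌋
    middle-level X = level D X ⌊ n /2⌋ (b≤n/2 X) (n/2+b≤n X)

  middle : Subset n → Subset n
  middle X = proj₁ (middle-level X)

  ∣middle∣ : ∀ X → ∣ middle X ∣ ≡ ⌊ n /2⌋
  ∣middle∣ X = proj₂ (proj₂ (middle-level X))

  middle-≡⇒chain-≡ : ∀ X Y → middle X ≡ middle Y → chain D X ≡ chain D Y
  middle-≡⇒chain-≡ X Y e = trans (sym (proj₁ (proj₂ (middle-level X))))
    (trans (cong (chain D) e) (proj₁ (proj₂ (middle-level Y))))

  middle-≡⇒adjacent : ∀ X Y → middle X ≡ middle Y → X ≢ Y → SpernerAdj X Y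
  middle-≡⇒adjacent X Y e X≢Y with ≤-total ∣ X ∣ ∣ Y ∣
  ... | inj₁ p = inj₁ (⊆∧≢⇒⊂ X Y (nested D X Y (middle-≡⇒chain-≡ X Y e) p) X≢Y)
  ... | inj₂ p = inj₂ (⊆∧≢⇒⊂ Y X (nested D Y X (sym (middle-≡⇒chain-≡ X Y e)) p) (X≢Y ∘ sym))

middleLayer : ∀ n → List (Subset n)
middleLayer n = filter (λ X → ∣ X ∣ ≟ ⌊ n /2⌋) (allSubsets n)

middleLayer-unique : ∀ n → Unique (middleLayer n)
middleLayer-unique n = Unique.filter⁺ (λ X → ∣ X ∣ ≟ ⌊ n /2⌋) (allSubsets-unique n)

middleLayer-indep : ∀ n → IsIndep (B n) (middleLayer n)
middleLayer-indep n = (middleLayer-unique n , All.tabulate (λ {X} _ → allSubsets-complete X)) ,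
  AllPairs-mapWith {R = λ X Y → X ≢ Y} same-size (All.tabulate (λ X∈ → proj₂ (∈-filter⁻ (λ X → ∣ X ∣ ≟ ⌊ n /2⌋) {xs = allSubsets n} X∈))) (middleLayer-unique n)
  where
  same-size : {X Y : Subset n} → ∣ X ∣ ≡ ⌊ n /2⌋ → ∣ Y ∣ ≡ ⌊ n /2⌋ → X ≢ Y → ¬ SpernerAdj X Y
  same-size p q _ (inj₁ r) = <⇒≢ (Subset.p⊂q⇒∣p∣<∣q∣ r) (trans p (sym q))
  same-size p q _ (inj₂ r) = <⇒≢ (Subset.p⊂q⇒∣p∣<∣q∣ r) (trans q (sym p))

-- Uniform weightings

ceilDiv-cases : ∀ m s → ceilDiv m s ≡ floorDiv m s ⊎ ceilDiv m s ≡ suc (floorDiv m s)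
ceilDiv-cases m zero    = inj₁ refl
ceilDiv-cases m (suc t) with m≤n⇒m<n∨m≡n ceil≤
  where
  -- Raising the numerator m + t to m + (t + 1) gives a quotient of exactly one more than the floor.
  ceil≤ : ceilDiv m (suc t) ≤ suc (floorDiv m (suc t))
  ceil≤ = ≤-trans (/-monoˡ-≤ (suc t) (+-monoʳ-≤ m (n≤1+n t)))
    (≤-reflexive (trans (+-distrib-/-∣ʳ m {suc t} ∣-refl)
      (trans (cong (m / suc t +_) (n/n≡1 (suc t))) (+-comm _ 1))))
... | inj₁ lt = inj₁ (≤-antisym (≤-pred lt) (/-monoˡ-≤ (suc t) (m≤m+n m t)))
... | inj₂ eq = inj₂ eq

UniformOn-cases : ∀ {G m w U} → UniformOn G m w U → ∀ {u} → u ∈ U →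
                  w u ≡ floorDiv m (length U) ⊎ w u ≡ suc (floorDiv m (length U))
UniformOn-cases {m = m} {U = U} (_ , unif) u∈ with unif _ u∈
... | inj₁ e = inj₁ e
... | inj₂ e with ceilDiv-cases m (length U)
...   | inj₁ f = inj₁ (trans e f)
...   | inj₂ f = inj₂ (trans e f)

-- The member `u` excludes the empty list, on which `floorDiv` has the default value 0.
floorDiv-≥ : ∀ {m} k {u : A} {U} → u ∈ U → k * length U ≤ m → k ≤ floorDiv m (length U)
floorDiv-≥ k {U = _ ∷ U} _ km =
  ≤-trans (≤-reflexive (sym (m*n/n≡m k (suc (length U))))) (/-monoˡ-≤ (suc (length U)) km)

UniformOn-≥ : ∀ {G m w U} → UniformOn G m w U → ∀ k → k * length U ≤ m → ∀ {u} → u ∈ U → k ≤ w u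
UniformOn-≥ {G} unif k km u∈ with UniformOn-cases {G} unif u∈
... | inj₁ e = ≤-trans (floorDiv-≥ k u∈ km) (≤-reflexive (sym e))
... | inj₂ e = ≤-trans (m≤n⇒m≤1+n (floorDiv-≥ k u∈ km)) (≤-reflexive (sym e))

-- Clique counts in the two blow-ups

module _ (n k : ℕ) (w : Subset n → ℕ) where
  open Blocks (_≟V_ (B n)) w

  private
    L : List (Subset n × ℕ)
    L = verts (blowUp (B n) w)

  -- Blocks outside U are empty, and adjacent copies over an independent set replace the same
  -- vertex, so every clique lies in a single block. The first component also serves to compute the
  -- total weight on U.
  cliques-≤ : (U : List (Subset n)) → IsIndep (B n) U → (∀ v → v ∉ U → w v ≡ 0) →
              All (λ x → proj₁ x ∈ U) L × π (suc k) (blowUp (B n) w) ≤ sum (map (_C suc k) (map w U))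
  cliques-≤ U ((U! , _) , indep) supp = L⊆U , (begin
    π (suc k) (blowUp (B n) w)                                      ≤⟨ length-filter-mono (allPairs? (adj? (blowUp (B n) w))) monochromatic? (combinations (suc k) L) clique⇒mono ⟩
    length (filter monochromatic? (combinations (suc k) L))         ≡⟨ count-monochromatic U! k L L⊆U ⟩
    sum (map (λ u → classSize L u C suc k) U)                       ≡⟨ sum-map-cong U (λ {u} _ → cong (_C suc k) (classSize-blocks (allSubsets-unique n) (allSubsets-complete u))) ⟩
    sum (map (λ u → w u C suc k) U)                                 ≡⟨ cong sum (map-∘ U) ⟩
    sum (map (_C suc k) (map w U))                                  ∎)
    where
    open ≤-Reasoning
    open Colouring {A = Subset n × ℕ} (_≟V_ (B n)) proj₁

    L⊆U : All (λ x → proj₁ x ∈ U) L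
    L⊆U = All.tabulate λ {x} x∈ → decidable-stable (any? (proj₁ x ≟ˢ_) U) λ x∉ →
      n≮0 (≤-trans (proj₂ (∈-blocks⁻ (allSubsets n) x∈)) (≤-reflexive (supp _ x∉)))

    independent : ∀ {u v} → u ∈ U → v ∈ U → ¬ SpernerAdj u v
    independent = AllPairs-lookup SpernerAdj-irrefl (_∘ swap) indep

    clique⇒mono : ∀ {S} → S ∈ combinations (suc k) L → AllPairs (blowAdj (B n)) S → AllPairs (λ x y → proj₁ x ≡ proj₁ y) S
    clique⇒mono S∈ = AllPairs-mapWith same (All-resp-⊆ (combinations⇒⊆ (suc k) L S∈) L⊆U)
      where
      same : ∀ {x y} → proj₁ x ∈ U → proj₁ y ∈ U → blowAdj (B n) x y → proj₁ x ≡ proj₁ y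
      same _  _  (inj₁ (e , _)) = e
      same u∈ v∈ (inj₂ a)       = ⊥-elim (independent u∈ v∈ a)

  -- The clique consists of one copy of X and the first k copies of Y. It meets both vertices, so it
  -- lies in no chain when X and Y are in different ones.
  clique-through : ∀ {X Y} → SpernerAdj X Y → X ∷ Y ∷ [] ⊆ allSubsets n → 1 ≤ w X → k ≤ w Y →
                   ∃ λ S → (X , 0) ∷ S ⊆ L × length S ≡ k × All (λ x → proj₁ x ≡ Y) S × AllPairs (blowAdj (B n)) ((X , 0) ∷ S)
  clique-through {X} {Y} adj τ 1≤ k≤ = map (Y ,_) (upTo k) ,
    ⊆-trans (Sublist.++⁺ (Sublist.map⁺ (X ,_) (applyUpTo-⊆ _ 1≤))
                         (Sublist.++⁺ʳ [] (Sublist.map⁺ (Y ,_) (applyUpTo-⊆ _ k≤))))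
            (concatMap-⊆ block τ) ,
    trans (length-map _ (upTo k)) (length-upTo k) ,
    All.map⁺ (All.universal (λ _ → refl) (upTo k)) ,
    All.map⁺ (All.universal (λ _ → inj₂ adj) (upTo k)) ∷
    AllPairs.map⁺ (AllPairs.map (λ i≢j → inj₁ (refl , i≢j)) (Unique.upTo⁺ k))

module _ (n k : ℕ) (w : Subset n → ℕ) (D : SymmetricChains n) where
  open Blocks (_≟V_ (B n)) w
  open Middle D
  open Colouring {A = Subset n × ℕ} (_≟V_ (B n)) (middle ∘ proj₁)

  private
    L : List (Subset n × ℕ)
    L = verts (blowUp (B n) w)

  chainWeights : List ℕ
  chainWeights = map (classSize L) (middleLayer n)

  private
    L-covered : All (λ x → middle (proj₁ x) ∈ middleLayer n) L
    L-covered = All.universal (λ x → ∈-filter⁺ (λ X → ∣ X ∣ ≟ ⌊ n /2⌋) (allSubsets-complete _) (∣middle∣ (proj₁ x))) L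

  sum-chainWeights : sum chainWeights ≡ length L
  sum-chainWeights = sum-classSizes (middleLayer-unique n) L L-covered

  -- Over one chain all copies are adjacent, so every monochromatic combination is a clique, and
  -- their number is the left-hand sum. A clique through X and Y is not monochromatic, which makes
  -- the inequality strict.
  cliques-> : ∀ {X Y} → SpernerAdj X Y → chain D X ≢ chain D Y →
              1 ≤ k → suc k ≤ w X → suc k ≤ w Y →
              sum (map (_C suc k) chainWeights) < π (suc k) (blowUp (B n) w)
  cliques-> {X} {Y} adj sep 1≤k wX wY = subst (_< π (suc k) (blowUp (B n) w))
    (trans (count-monochromatic (middleLayer-unique n) k L L-covered) (cong sum (map-∘ (middleLayer n))))
    (strict (pair-⊆ (allSubsets-complete X) (allSubsets-complete Y) (λ { refl → sep refl })))
    where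
    mono⇒clique : ∀ {S} → S ∈ combinations (suc k) L →
                  AllPairs (λ x y → middle (proj₁ x) ≡ middle (proj₁ y)) S → AllPairs (blowAdj (B n)) S
    -- The vertex list has no repetitions, so two copies of the same vertex in a combination have
    -- different indices.
    mono⇒clique S∈ mono = AllPairs.zipWith adjacent (mono , AllPairs-resp-⊆ (combinations⇒⊆ (suc k) L S∈) (blocks-unique (allSubsets-unique n)))
      where
      adjacent : ∀ {x y} → middle (proj₁ x) ≡ middle (proj₁ y) × x ≢ y → blowAdj (B n) x y
      adjacent {u , i} {v , j} (e , x≢y) with u ≟ˢ v
      ... | yes refl = inj₁ (refl , λ { refl → x≢y refl })
      ... | no  u≢v  = inj₂ (middle-≡⇒adjacent u v e u≢v)

    strict′ : ∀ {P Q} → SpernerAdj P Q → chain D P ≢ chain D Q → P ∷ Q ∷ [] ⊆ allSubsets n → 1 ≤ w P → k ≤ w Q →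
      length (filter monochromatic? (combinations (suc k) L)) < π (suc k) (blowUp (B n) w)
    strict′ {P} {Q} adj sep τ wP wQ with clique-through n k w adj τ wP wQ
    ... | S , S⊆ , refl , S≡ , clique = length-filter-mono-< monochromatic? (allPairs? (adj? (blowUp (B n) w)))
            (combinations (suc k) L) mono⇒clique (⊆⇒combinations S⊆) clique (¬mono S S≡ 1≤k)
      where
      -- As k ≥ 1, the clique contains a copy of Q beside the copy of P, and equal colours would put
      -- P and Q in one chain.
      ¬mono : ∀ S → All (λ x → proj₁ x ≡ Q) S → 1 ≤ length S →
              ¬ AllPairs (λ x y → middle (proj₁ x) ≡ middle (proj₁ y)) ((P , 0) ∷ S)
      ¬mono (_ ∷ _) (refl ∷ _) _ ((e ∷ _) ∷ _) = sep (middle-≡⇒chain-≡ P Q e)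

    strict : (X ∷ Y ∷ [] ⊆ allSubsets n) ⊎ (Y ∷ X ∷ [] ⊆ allSubsets n) →
      length (filter monochromatic? (combinations (suc k) L)) < π (suc k) (blowUp (B n) w)
    -- The vertex that is enumerated first contributes the single copy.
    strict (inj₁ τ) = strict′ adj sep τ (≤-trans (s≤s z≤n) wX) (<⇒≤ wY)
    strict (inj₂ τ) = strict′ (swap adj) (sep ∘ sym) τ (≤-trans (s≤s z≤n) wY) (<⇒≤ wX)

-- Comparable pairs in a largest k-clique independent set

no-clique : ∀ {k} → 3 ≤ k → {Z : Subset n} {I : List (Subset n)} →
            (∀ {X Y S} → X ∷ Y ∷ S ⊆ I → ¬ SpernerAdj X Y) →
            ∀ S → S ⊆ Z ∷ I → length S ≡ k → ¬ AllPairs SpernerAdj S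
no-clique ()                  _    []              _ refl
no-clique (s≤s ())            _    (_ ∷ [])        _ refl
no-clique (s≤s (s≤s ()))      _    (_ ∷ _ ∷ [])    _ refl
-- A sublist of `Z ∷ I` without its first member is a sublist of `I`, so the second and third
-- members are adjacent and both in `I`.
no-clique _                   free (_ ∷ _ ∷ _ ∷ _) τ _ (_ ∷ (a ∷ _) ∷ _) = free (Sublist.∷⁻ τ) a

three-≤-α : ∀ n k → 2 ≤ n → 3 ≤ k → ∃ λ J → IsKCliqueIndep (B n) k J × length J ≡ 3
three-≤-α (suc (suc n)) k (s≤s (s≤s _)) 3≤k = J , ((J! , All.tabulate (λ {X} _ → allSubsets-complete X)) , no-clique 3≤k adjacent-free) , refl
  where
  J : List (Subset (suc (suc n)))
  -- The empty set and two singletons; the singletons have equal sizes and are incomparable.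
  J = ∅ ∷ (inside ∷ outside ∷ ∅) ∷ (outside ∷ inside ∷ ∅) ∷ []
  J! : Unique J
  J! = ((λ ()) ∷ (λ ()) ∷ []) ∷ ((λ ()) ∷ []) ∷ [] ∷ []
  adjacent-free : ∀ {X Y S} → X ∷ Y ∷ S ⊆ (inside ∷ outside ∷ ∅) ∷ (outside ∷ inside ∷ ∅) ∷ [] → ¬ SpernerAdj X Y
  adjacent-free (refl ∷ refl ∷ _) (inj₁ p) = <-irrefl refl (Subset.p⊂q⇒∣p∣<∣q∣ p)
  adjacent-free (refl ∷ refl ∷ _) (inj₂ p) = <-irrefl refl (Subset.p⊂q⇒∣p∣<∣q∣ p)
  adjacent-free (_ ∷ (_ ∷ʳ ()))
  adjacent-free (_ ∷ʳ (_ ∷ ()))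
  adjacent-free (_ ∷ʳ (_ ∷ʳ ()))

pigeonhole₂ : {a b : A} (xs : List A) → Unique xs → All (λ x → x ≡ a ⊎ x ≡ b) xs → length xs ≤ 2
pigeonhole₂ [] _ _ = z≤n
pigeonhole₂ (_ ∷ []) _ _ = s≤s z≤n
pigeonhole₂ (_ ∷ _ ∷ []) _ _ = s≤s (s≤s z≤n)
pigeonhole₂ (_ ∷ _ ∷ _ ∷ _) ((p ∷ q ∷ _) ∷ (r ∷ _) ∷ _) (inj₁ refl ∷ inj₁ refl ∷ _) = ⊥-elim (p refl)
pigeonhole₂ (_ ∷ _ ∷ _ ∷ _) ((p ∷ q ∷ _) ∷ (r ∷ _) ∷ _) (inj₂ refl ∷ inj₂ refl ∷ _) = ⊥-elim (p refl)
pigeonhole₂ (_ ∷ _ ∷ _ ∷ _) ((p ∷ q ∷ _) ∷ (r ∷ _) ∷ _) (inj₁ refl ∷ _ ∷ inj₁ refl ∷ _) = ⊥-elim (q refl)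
pigeonhole₂ (_ ∷ _ ∷ _ ∷ _) ((p ∷ q ∷ _) ∷ (r ∷ _) ∷ _) (inj₂ refl ∷ _ ∷ inj₂ refl ∷ _) = ⊥-elim (q refl)
pigeonhole₂ (_ ∷ _ ∷ _ ∷ _) ((p ∷ q ∷ _) ∷ (r ∷ _) ∷ _) (_ ∷ inj₁ refl ∷ inj₁ refl ∷ _) = ⊥-elim (r refl)
pigeonhole₂ (_ ∷ _ ∷ _ ∷ _) ((p ∷ q ∷ _) ∷ (r ∷ _) ∷ _) (_ ∷ inj₂ refl ∷ inj₂ refl ∷ _) = ⊥-elim (r refl)

-- Suppose (∅, full) is the only possible comparable pair. If ∅ is in `I`, every other member is
-- `full`, so `I` has at most two members, fewer than the three of `three-≤-α`. Otherwise `I` is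
-- independent and can be enlarged by ∅, because k ≥ 3.
nontrivial-pair : ∀ n k → 2 ≤ n → 3 ≤ k → (I : List (Subset n)) → IsMaxKCliqueIndep (B n) k I →
  ¬ (∀ {X Y} → X ∈ I → Y ∈ I → X ⊂ Y → X ≡ ∅ × Y ≡ full)
nontrivial-pair n k 2≤n 3≤k I (((I! , _) , _) , max) ext with any? (∅ ≟ˢ_) I
... | yes ∅∈I with J , indep , e ← three-≤-α n k 2≤n 3≤k =
  <⇒≱ (≤-trans (≤-reflexive (sym e)) (max J indep))
      (pigeonhole₂ I I! (All.tabulate ∅⊎full))
  where
  ∅⊎full : ∀ {Z} → Z ∈ I → Z ≡ ∅ ⊎ Z ≡ full
  ∅⊎full {Z} Z∈ with Z ≟ˢ ∅
  ... | yes e = inj₁ e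
  ... | no ¬e = inj₂ (proj₂ (ext ∅∈I Z∈ (⊆∧≢⇒⊂ ∅ Z Subset.⊥⊆ (¬e ∘ sym))))
... | no ∅∉I = <⇒≱ ≤-refl (max (∅ ∷ I) ((All.¬Any⇒All¬ I ∅∉I ∷ I! , All.tabulate (λ {X} _ → allSubsets-complete X)) , no-clique 3≤k adjacent-free))
  where
  adjacent-free : ∀ {X Y S} → X ∷ Y ∷ S ⊆ I → ¬ SpernerAdj X Y
  adjacent-free τ a = incomparable (to∈ τ) (to∈ (Sublist.∷ˡ⁻ τ)) a
    where
    incomparable : ∀ {X Y} → X ∈ I → Y ∈ I → ¬ SpernerAdj X Y
    incomparable X∈ Y∈ (inj₁ p) with refl , _ ← ext X∈ Y∈ p = ∅∉I X∈
    incomparable X∈ Y∈ (inj₂ p) with refl , _ ← ext Y∈ X∈ p = ∅∉I Y∈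

theorem9 : (n k m a : ℕ) → 2 ≤ n → 3 ≤ k → IsAlphaK (B n) k a → k * a ≤ m →
    (w w' : Subset n → ℕ) →
    IsWeighting (B n) m w → IsWeighting (B n) m w' →
    UniformAlpha (B n) m w →
    (I : List (Subset n)) → IsMaxKCliqueIndep (B n) k I → UniformOn (B n) m w' I →
    π k (blowUp (B n) w) < π k (blowUp (B n) w')
theorem9 n (suc k) m a 2≤n 3≤k (I₀ , (indep₀ , max₀) , refl) ka≤m w w' Σw Σw' (U , (indepU , maxU) , unifU) I (indepI , maxI) unifI =
  -- The inequality is decidable, so it may be assumed false. Then no pair X ⊂ Y in `I` other than
  -- (∅, full) exists, contrary to `nontrivial-pair`.
  decidable-stable (_ <? _) λ ¬goal →
    nontrivial-pair n (suc k) 2≤n 3≤k I (indepI , maxI) λ {X} {Y} X∈ Y∈ X⊂Y →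
      decidable-stable ((X ≟ˢ ∅) ×-dec (Y ≟ˢ full)) λ ¬ext → ¬goal (from-pair X∈ Y∈ X⊂Y ¬ext)
  where
  heavy : ∀ {X} → X ∈ I → suc k ≤ w' X
  -- The list `I₀` realises α_k and `I` is no longer than it, so the bound on m applies to the
  -- length of `I`.
  heavy = UniformOn-≥ {B n} unifI (suc k) (≤-trans (*-monoʳ-≤ (suc k) (max₀ I indepI)) ka≤m)

  module B = Blocks (_≟V_ (B n))

  sum-U : sum (map w U) ≡ m
  -- Both sides count the vertices of the blow-up, all of which lie over U: first by their vertex in
  -- U, then block by block.
  sum-U = trans (sum-map-cong U (λ {u} _ → sym (B.classSize-blocks w (allSubsets-unique n) (allSubsets-complete u))))
    (trans (Colouring.sum-classSizes (_≟V_ (B n)) proj₁ (proj₁ (proj₁ indepU)) _ (proj₁ (cliques-≤ n k w U indepU (proj₁ unifU))))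
      (trans (B.length-blocks w (allSubsets n)) Σw))

  from-pair : ∀ {X Y} → X ∈ I → Y ∈ I → X ⊂ Y → ¬ (X ≡ ∅ × Y ≡ full) →
              π (suc k) (blowUp (B n) w) < π (suc k) (blowUp (B n) w')
  from-pair {X} {Y} X∈ Y∈ X⊂Y ¬ext with D , sep ← separating X Y X⊂Y ¬ext = begin-strict
    π (suc k) (blowUp (B n) w)                        ≤⟨ proj₂ (cliques-≤ n k w U indepU (proj₁ unifU)) ⟩
    -- Both lists have total m. The chains are indexed by the middle layer, an independent set, so
    -- there are at most as many of them as members of U.
    sum (map (_C suc k) (map w U))                    ≤⟨ balanced-minimises-ΣC k (floorDiv m (length U)) (map w U) (chainWeights n k w' D)
                                                           (All.map⁺ (All.tabulate (UniformOn-cases {B n} unifU)))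
                                                           (trans sum-U (sym (trans (sum-chainWeights n k w' D) (trans (B.length-blocks w' (allSubsets n)) Σw'))))
                                                           (subst₂ _≤_ (sym (length-map _ (middleLayer n))) (sym (length-map w U)) (maxU (middleLayer n) (middleLayer-indep n))) ⟩
    sum (map (_C suc k) (chainWeights n k w' D))      <⟨ cliques-> n k w' D (inj₁ X⊂Y) sep (≤-trans (s≤s z≤n) (≤-pred 3≤k)) (heavy X∈) (heavy Y∈) ⟩
    π (suc k) (blowUp (B n) w')                       ∎
    where open ≤-Reasoning
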